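{- Let $G$ be a generalised dihedral group of order $2n$ over the abelian group $A$, and let $\Gamma=\mathrm{Cay}(G,S)$. If $|S\cap xA|\le 2$, then $\gamma_{\mathrm{all}}^\infty(\Gamma)=\gamma(\Gamma)$.
   Context: Groups and graphs are finite. For an abelian group $A$, the generalised dihedral group over $A$ is $G=\langle A,x : x^2=1,\ x^{ -1}ax=a^{ -1}\ \forall a\in A\rangle$, i.e. the semidirect product $A\rtimes\langle x\rangle$ with $x\notin A$ of order 2 acting by inversion; $xA$ is the nontrivial coset of $A$. For a group $G$ and an inverse-closed subset $S\subseteq G$, $\mathrm{Cay}(G,S)$ is the graph with vertex set $G$ and an edge from $u$ to $us$ for every $u\in G$, $s\in S$. The identity may be allowed in $S$ (giving a loop at every vertex); such loops are irrelevant to domination. A vertex $u$ dominates a vertex $w$ if $w=u$ or $w$ is adjacent to $u$. A dominating set is a set $D$ of vertices such that every vertex is dominated by at least one vertex of $D$; $\gamma(\Gamma)$ is the smallest size of a dominating set of $\Gamma$. Guards located at the vertices of a set $D$ (one guard per vertex) can reconfigure to a set $D'$ if there is a bijection $f:D\to D'$ such that for every $d\in D$, either $f(d)=d$ or $f(d)$ is adjacent to $d$. An eternal dominating configuration for $\Gamma$ is a nonempty collection $\mathcal D$ of subsets of $V(\Gamma)$, all of the same cardinality, such that for every $D_i\in\mathcal D$ and every vertex $w\notin D_i$ there is $D_j\in\mathcal D$ with $w\in D_j$ such that guards at $D_i$ can reconfigure to $D_j$. An eternal dominating set is a member of some eternal dominating configuration. The eternal domination number $\gamma_{\mathrm{all}}^\infty(\Gamma)$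 is the smallest cardinality of an eternal dominating set. -}

module Defs where

open import Algebra.Bundles using (Group; AbelianGroup)
open import Algebra.Morphism.Structures using (module GroupMorphisms)
import Algebra.Properties.Group as GroupProperties
open import Data.Fin.Base using (Fin)
open import Data.Fin.Subset using (Subset; _∈_; _∉_; ∣_∣)
open import Data.Nat.Base using (ℕ; _≤_)
open import Data.Product.Base using (Σ; ∃; ∃-syntax; _×_; _,_; proj₁)
open import Data.Sum.Base using (_⊎_; inj₁; inj₂)
open import Data.Vec.Base using (tabulate)
open import Function.Base using (_∘_)
open import Function.Bundles using (Inverse; Bijection; _⤖_)
open import Level using (Level; _⊔_; 0ℓ) renaming (suc to lsuc)
open import Relation.Binary.Core using (Rel)
open import Relation.Binary.Definitions using (Symmetric)
open import Relation.Binary.PropositionalEquality.Core using (_≡_)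
import Relation.Binary.PropositionalEquality.Properties as ≡
import Relation.Binary.Reasoning.Setoid as SetoidReasoning
open import Relation.Nullary.Decidable.Core using (yes; no; does)
open import Relation.Nullary.Negation.Core using (¬_)
open import Relation.Unary using (Pred; Decidable; Satisfiable)

------------------------------------------------------------------------
-- Graphs and domination

-- Loops are not excluded: the identity may belong to a connection set.
record Graph (ℓ : Level) (m : ℕ) : Set (lsuc ℓ) where
  field
    Adjacent : Rel (Fin m) ℓ
    sym      : Symmetric Adjacent

module _ {ℓ : Level} {m : ℕ} (Γ : Graph ℓ m) where

  open Graph Γ

  Dominates : Rel (Fin m) ℓ
  Dominates u w = w ≡ u ⊎ Adjacent u w

  IsDominatingSet : Pred (Subset m) ℓ
  IsDominatingSet D = ∀ w → ∃[ u ] u ∈ D × Dominates u w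

  -- Membership in a Subset is proof-irrelevant, so ∃ (_∈ D) is the set D.
  Reconfigures : Rel (Subset m) ℓ
  Reconfigures D D′ =
    Σ (∃ (_∈ D) ⤖ ∃ (_∈ D′)) λ f →
      ∀ d → let v = proj₁ d ; w = proj₁ (Bijection.to f d) in
            w ≡ v ⊎ Adjacent v w

  record IsEternalDominatingConfiguration
         (𝒟 : Pred (Subset m) 0ℓ) : Set ℓ where
    field
      nonempty        : Satisfiable 𝒟
      sameCardinality : ∀ {D D′} → 𝒟 D → 𝒟 D′ → ∣ D ∣ ≡ ∣ D′ ∣
      defend          : ∀ {D} → 𝒟 D → ∀ w → w ∉ D →
                        ∃[ D′ ] 𝒟 D′ × w ∈ D′ × Reconfigures D D′

  IsEternalDominatingSet : Pred (Subset m) (lsuc 0ℓ ⊔ ℓ)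
  IsEternalDominatingSet D =
    ∃[ 𝒟 ] IsEternalDominatingConfiguration 𝒟 × 𝒟 D

IsSmallestSize : ∀ {p} {m} → Pred (Subset m) p → Pred ℕ p
IsSmallestSize P k = (∃[ D ] P D × ∣ D ∣ ≡ k) × (∀ D → P D → k ≤ ∣ D ∣)

-- "γ(Γ) = k" and "γ∞all(Γ) = k", as relations between Γ and k; at most one k
-- satisfies each.
IsDominationNumber : ∀ {ℓ m} → Graph ℓ m → Pred ℕ ℓ
IsDominationNumber Γ = IsSmallestSize (IsDominatingSet Γ)

IsEternalDominationNumber : ∀ {ℓ m} → Graph ℓ m → Pred ℕ (lsuc 0ℓ ⊔ ℓ)
IsEternalDominationNumber Γ = IsSmallestSize (IsEternalDominatingSet Γ)

------------------------------------------------------------------------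
-- Finite groups and Cayley graphs

-- The enumeration lets subsets of G be library Subsets, with their
-- cardinality, and lets graphs on G be graphs on Fin order.
record FiniteGroup (c ℓ : Level) : Set (lsuc (c ⊔ ℓ)) where
  field
    group       : Group c ℓ
    order       : ℕ
    enumeration : Inverse (Group.setoid group) (≡.setoid (Fin order))

  open Group group public
  open Inverse enumeration public using () renaming (to to index; from to element)

  infix 4 _∈ᴳ_

  _∈ᴳ_ : Carrier → Subset order → Set
  g ∈ᴳ S = index g ∈ S

  InverseClosed : Subset order → Set c
  InverseClosed S = ∀ s → s ∈ᴳ S → s ⁻¹ ∈ᴳ S

  Cay : (S : Subset order) → InverseClosed S → Graph (c ⊔ ℓ) order
  Cay S inv = record
    { Adjacent = λ u v → ∃[ s ] s ∈ᴳ S × element v ≈ element u ∙ s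
    ; sym      = λ {u} {v} (s , s∈S , v≈us) → s ⁻¹ , inv s s∈S , (begin
        element u                ≈⟨ //-rightDividesʳ s (element u) ⟨
        element u ∙ s ∙ s ⁻¹     ≈⟨ ∙-congʳ v≈us ⟨
        element v ∙ s ⁻¹         ∎)
    }
    where
    open GroupProperties group using (//-rightDividesʳ)
    open SetoidReasoning setoid

------------------------------------------------------------------------
-- Generalised dihedral groups

-- G is the internal semidirect product of (an embedded copy of) A by ⟨x⟩,
-- with x acting by inversion.
record GeneralisedDihedral {a ℓa c ℓ : Level}
       (A : AbelianGroup a ℓa) (G : Group c ℓ) : Set (a ⊔ ℓa ⊔ c ⊔ ℓ) where
  private module A = AbelianGroup A
  open Group G
  open GroupMorphisms A.rawGroup rawGroup

  field
    ι              : A.Carrier → Carrier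
    ι-monomorphism : IsGroupMonomorphism ι
    x              : Carrier
    x∉A            : ∀ a → ¬ x ≈ ι a
    x²≈ε           : x ∙ x ≈ ε
    inverts        : ∀ a → x ⁻¹ ∙ ι a ∙ x ≈ ι (a A.⁻¹)
    cosets         : ∀ g → (∃[ a ] g ≈ ι a) ⊎ (∃[ a ] g ≈ x ∙ ι a)

  InXA : Pred Carrier (a ⊔ ℓ)
  InXA g = ∃[ a ] g ≈ x ∙ ι a

  inXA? : Decidable InXA
  inXA? g with cosets g
  ... | inj₂ g∈xA       = yes g∈xA
  ... | inj₁ (b , g≈ιb) = no λ (a , g≈xιa) → x∉A (b A.∙ a A.⁻¹) (begin
    x                      ≈⟨ //-rightDividesʳ (ι a) x ⟨
    x ∙ ι a ∙ ι a ⁻¹       ≈⟨ ∙-congʳ (trans (sym g≈xιa) g≈ιb) ⟩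
    ι b ∙ ι a ⁻¹           ≈⟨ ∙-congˡ (⁻¹-homo a) ⟨
    ι b ∙ ι (a A.⁻¹)       ≈⟨ ∙-homo b (a A.⁻¹) ⟨
    ι (b A.∙ a A.⁻¹)       ∎)
    where
    open IsGroupMonomorphism ι-monomorphism using (∙-homo; ⁻¹-homo)
    open GroupProperties G using (//-rightDividesʳ)
    open SetoidReasoning setoid

module _ {a ℓa c ℓ : Level} {A : AbelianGroup a ℓa} (G : FiniteGroup c ℓ)
         (dih : GeneralisedDihedral A (FiniteGroup.group G)) where

  open FiniteGroup G
  open GeneralisedDihedral dih

  xA : Subset order
  xA = tabulate (does ∘ inXA? ∘ element)

{-# OPTIONS --safe #-}

-- If every edge u ~ w is realised by a graph automorphism taking u to w and
-- every vertex to a neighbour, then all guards can move along that automorphism,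
-- so the dominating sets of size γ form an eternal dominating configuration.
-- For an edge u ~ us with s ∈ A, left multiplication by s (if u ∈ A) or by s⁻¹
-- (if u ∈ xA) is such an automorphism, as it is right multiplication by s^{±1} on
-- each coset of A.  If S ∩ xA = {s, t}, the map multiplying A by s and xA by t
-- on the right is one too: it carries the edge g ~ gs to gs ~ (gs)t, and gt ~ g
-- to g ~ gs.
module Submission where

open import Defs
open import Algebra.Bundles using (AbelianGroup)
import Algebra.Properties.CommutativeMonoid.Sum as Summation
import Algebra.Properties.Group as GroupProperties
open import Algebra.Morphism.Structures using (module GroupMorphisms)
open import Data.Bool.Base using (Bool; true; false; if_then_else_)
open import Data.Fin.Base using (Fin)
open import Data.Fin.Permutation using (Permutation′; _⟨$⟩ʳ_; _⟨$⟩ˡ_; inverseˡ; inverseʳ; permutation; flip)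
open import Data.Fin.Properties using (any?; all?; _≟_)
open import Data.Fin.Subset using (Subset; _∩_; _∈_; _-_; ∣_∣)
  renaming (⊤ to full)
open import Data.Fin.Subset.Properties
  using (_∈?_; ∈⊤; anySubset?; nonempty?; x∈p∩q⁺; x∈p∩q⁻; p─q⊆p; x∈p∧x≢y⇒x∈p-y; x∈p⇒∣p-x∣<∣p∣)
open import Data.Nat.Base using (ℕ; _*_; _≤_; _<_; z≤n; s≤s; suc)
open import Data.Nat.Induction using (<-wellFounded)
open import Data.Nat.Properties
  using (+-0-commutativeMonoid; _<?_; ≮⇒≥; <⇒≱; ≤-trans)
open import Data.Product.Base using (∃; ∃-syntax; _×_; _,_; proj₁; proj₂)
open import Data.Sum.Base using (_⊎_; inj₁; inj₂; [_,_]′)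
open import Data.Vec.Base using ([]; _∷_; lookup; tabulate)
open import Data.Vec.Properties using (lookup∘tabulate; []=⇒lookup; lookup⇒[]=)
open import Data.Vec.Properties.WithK using ([]=-irrelevant)
open import Function.Base using (_∘_; const)
open import Function.Bundles using (Inverse; Bijection; mk⤖)
open import Induction.WellFounded using (Acc; acc)
open import Level using (Level)
open import Relation.Binary.Definitions using (Decidable)
open import Relation.Binary.PropositionalEquality.Core
  using (_≡_; refl; sym; trans; cong; subst)
open import Relation.Binary.PropositionalEquality.Properties using (module ≡-Reasoning)
import Relation.Binary.Reasoning.Setoid as SetoidReasoning
open import Relation.Nullary.Decidable
  using (Dec; yes; no; does; True; toWitness; fromWitness; dec-true; map′; _×-dec_; _⊎-dec_)
open import Relation.Nullary.Negation using (¬_; contradiction)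
import Relation.Unary as Unary

-- Subsets of finite sets

does⁻ : ∀ {p} {P : Set p} (P? : Dec P) → does P? ≡ true → P
does⁻ (yes p) _ = p

module _ {m : ℕ} where

  ∈-tabulate⁺ : ∀ {f : Fin m → Bool} {i} → f i ≡ true → i ∈ tabulate f
  ∈-tabulate⁺ {f} {i} fi = lookup⇒[]= i _ (trans (lookup∘tabulate f i) fi)

  ∈-tabulate⁻ : ∀ {f : Fin m → Bool} {i} → i ∈ tabulate f → f i ≡ true
  ∈-tabulate⁻ {f} {i} i∈ = trans (sym (lookup∘tabulate f i)) ([]=⇒lookup i∈)

  image : Permutation′ m → Subset m → Subset m
  image π D = tabulate (λ v → lookup D (π ⟨$⟩ˡ v))

  ∈-image⁺ : ∀ (π : Permutation′ m) {D v} → v ∈ D → π ⟨$⟩ʳ v ∈ image π D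
  ∈-image⁺ π {D} v∈D = ∈-tabulate⁺ (trans (cong (lookup D) (inverseˡ π)) ([]=⇒lookup v∈D))

  ∈-image⁻ : ∀ (π : Permutation′ m) {D v} → v ∈ image π D → π ⟨$⟩ˡ v ∈ D
  ∈-image⁻ π {D} v∈πD = lookup⇒[]= _ D (∈-tabulate⁻ v∈πD)

open Summation +-0-commutativeMonoid using (sum; sum-permute; sum-cong-≗)

indicator : ∀ {m} → Subset m → Fin m → ℕ
indicator D i = if lookup D i then 1 else 0

∣p∣≡sum : ∀ {m} (p : Subset m) → ∣ p ∣ ≡ sum (indicator p)
∣p∣≡sum []          = refl
∣p∣≡sum (true  ∷ p) = cong suc (∣p∣≡sum p)
∣p∣≡sum (false ∷ p) = ∣p∣≡sum p

-- Written as a sum of 0/1 values, a cardinality is invariant under reindexing by a permutation.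
∣image∣ : ∀ {m} (π : Permutation′ m) (D : Subset m) → ∣ image π D ∣ ≡ ∣ D ∣
∣image∣ {m} π D = begin
  ∣ image π D ∣                         ≡⟨ ∣p∣≡sum (image π D) ⟩
  sum (indicator (image π D))           ≡⟨ sum-cong-≗ {m} indicator-image ⟩
  sum (λ i → indicator D (π ⟨$⟩ˡ i))    ≡⟨ sum-permute (indicator D) (flip π) ⟨
  sum (indicator D)                     ≡⟨ ∣p∣≡sum D ⟨
  ∣ D ∣                                 ∎
  where
  open ≡-Reasoning
  indicator-image : ∀ i → indicator (image π D) i ≡ indicator D (π ⟨$⟩ˡ i)
  indicator-image i = cong (if_then 1 else 0) (lookup∘tabulate (λ v → lookup D (π ⟨$⟩ˡ v)) i)

-- Three distinct elements could be removed one after another, forcing size at least 3. When `i` is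
-- the only element of `p`, the partner returned is `i` itself.
∣p∣≤2⇒partner : ∀ {m} (p : Subset m) → ∣ p ∣ ≤ 2 → ∀ {i} → i ∈ p →
                ∃[ j ] j ∈ p × (∀ {k} → k ∈ p → k ≡ i ⊎ k ≡ j)
∣p∣≤2⇒partner p ∣p∣≤2 {i} i∈p with nonempty? (p - i)
... | no  p-i≡∅ = i , i∈p , only
  where
  only : ∀ {k} → k ∈ p → k ≡ i ⊎ k ≡ i
  only {k} k∈p with k ≟ i
  ... | yes k≡i = inj₁ k≡i
  ... | no  k≢i = contradiction (k , x∈p∧x≢y⇒x∈p-y k∈p k≢i) p-i≡∅
... | yes (j , j∈p-i) = j , p─q⊆p p _ j∈p-i , only
  where
  only : ∀ {k} → k ∈ p → k ≡ i ⊎ k ≡ j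
  only {k} k∈p with k ≟ i | k ≟ j
  ... | yes k≡i | _       = inj₁ k≡i
  ... | no  _   | yes k≡j = inj₂ k≡j
  ... | no  k≢i | no  k≢j = contradiction ∣p∣≤2 (<⇒≱ 2<∣p∣)
    where
    k∈p-i-j : k ∈ p - i - j
    k∈p-i-j = x∈p∧x≢y⇒x∈p-y (x∈p∧x≢y⇒x∈p-y k∈p k≢i) k≢j
    2<∣p∣ : 2 < ∣ p ∣
    2<∣p∣ = ≤-trans (s≤s (≤-trans (s≤s (≤-trans (s≤s z≤n)
              (x∈p⇒∣p-x∣<∣p∣ k∈p-i-j))) (x∈p⇒∣p-x∣<∣p∣ j∈p-i))) (x∈p⇒∣p-x∣<∣p∣ i∈p)

-- Well-founded descent on cardinality: a strictly smaller subset satisfying `P` is either found by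
-- exhaustive search or ruled out.
smallestSize : ∀ {p m} {P : Unary.Pred (Subset m) p} → Unary.Decidable P →
               ∃ P → ∃ (IsSmallestSize P)
smallestSize {P = P} P? (D₀ , PD₀) = go D₀ PD₀ (<-wellFounded _)
  where
  go : ∀ D → P D → Acc _<_ ∣ D ∣ → ∃ (IsSmallestSize P)
  go D PD (acc rec) with anySubset? (λ E → P? E ×-dec (∣ E ∣ <? ∣ D ∣))
  ... | yes (E , PE , E<D) = go E PE (rec E<D)
  ... | no  none = ∣ D ∣ , (D , PD , refl) , λ E PE → ≮⇒≥ λ E<D → none (E , PE , E<D)

-- Eternal domination by automorphisms

module _ {ℓ : Level} {m : ℕ} (Γ : Graph ℓ m) where

  open Graph Γ using (Adjacent)

  -- A permutation of a finite graph that maps edges to edges is already an automorphism, so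
  -- `preserve` asks for one direction. By `moves`, all guards may follow it at once, wherever they
  -- stand.
  record Shift : Set ℓ where
    field
      perm     : Permutation′ m
      preserve : ∀ {u v} → Adjacent u v → Adjacent (perm ⟨$⟩ʳ u) (perm ⟨$⟩ʳ v)
      moves    : ∀ v → Adjacent v (perm ⟨$⟩ʳ v)

  module _ (φ : Shift) where
    open Shift φ

    -- Pull `w` back along the permutation, dominate it there, and push the dominating vertex
    -- forward.
    image-dominating : ∀ {D} → IsDominatingSet Γ D → IsDominatingSet Γ (image perm D)
    image-dominating dom w with dom (perm ⟨$⟩ˡ w)
    ... | u , u∈D , inj₁ w≡u = perm ⟨$⟩ʳ u , ∈-image⁺ perm u∈D ,
      inj₁ (trans (sym (inverseʳ perm)) (cong (perm ⟨$⟩ʳ_) w≡u))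
    ... | u , u∈D , inj₂ u~w = perm ⟨$⟩ʳ u , ∈-image⁺ perm u∈D ,
      inj₂ (subst (Adjacent _) (inverseʳ perm) (preserve u~w))

    reconfigures-image : ∀ D → Reconfigures Γ D (image perm D)
    reconfigures-image D = mk⤖ {to = to} (to-injective , to-surjective) , λ (v , _) → inj₂ (moves v)
      where
      to : ∃ (_∈ D) → ∃ (_∈ image perm D)
      to (v , v∈D) = perm ⟨$⟩ʳ v , ∈-image⁺ perm v∈D

      ∃∈-≡ : ∀ {E : Subset m} {p q : ∃ (_∈ E)} → proj₁ p ≡ proj₁ q → p ≡ q
      ∃∈-≡ refl = cong (_ ,_) ([]=-irrelevant _ _)

      to-injective : ∀ {p q} → to p ≡ to q → p ≡ q
      to-injective eq = ∃∈-≡ (trans (sym (inverseˡ perm))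
        (trans (cong (λ e → perm ⟨$⟩ˡ proj₁ e) eq) (inverseˡ perm)))

      to-surjective : ∀ q → ∃[ p ] (∀ {r} → r ≡ p → to r ≡ q)
      to-surjective (w , w∈) = (perm ⟨$⟩ˡ w , ∈-image⁻ perm w∈) , λ { refl → ∃∈-≡ (inverseʳ perm) }

  -- Attack a vertex `w` outside `D`: the guard that ends on `w` started at a vertex of `D`
  -- dominating `w`.
  eternal⇒dominating : ∀ {D} → IsEternalDominatingSet Γ D → IsDominatingSet Γ D
  eternal⇒dominating {D} (𝒟 , config , D∈𝒟) w with w ∈? D
  ... | yes w∈D = w , w∈D , inj₁ refl
  ... | no  w∉D with IsEternalDominatingConfiguration.defend config D∈𝒟 w w∉D
  ...   | D′ , _ , w∈D′ , f , step with Bijection.strictlySurjective f (w , w∈D′)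
  ...     | (u , u∈D) , fu≡w = u , u∈D , subst (Dominates Γ u) (cong proj₁ fu≡w) (step (u , u∈D))

  module _ (adjacent? : Decidable Adjacent)
           (shift : ∀ {u w} → Adjacent u w → ∃[ φ ] Shift.perm φ ⟨$⟩ʳ u ≡ w) where

    dominating? : Unary.Decidable (IsDominatingSet Γ)
    dominating? D = all? λ w → any? λ u → (u ∈? D) ×-dec ((w ≟ u) ⊎-dec adjacent? u w)

    -- Dominating sets are taken through their decision procedure because a
    -- configuration is a Pred at level 0ℓ.
    DominatingOfSize : ℕ → Unary.Pred (Subset m) _
    DominatingOfSize k D = True (dominating? D) × ∣ D ∣ ≡ k

    -- The size `k` is arbitrary, not only the minimum. An attack at `w` is answered by choosing a
    -- guard `u` that dominates `w` and moving all guards by a shift taking `u` to `w`.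
    dominatingOfSize-configuration : ∀ k → ∃ (DominatingOfSize k) →
                                     IsEternalDominatingConfiguration Γ (DominatingOfSize k)
    dominatingOfSize-configuration k inhabited = record
      { nonempty        = inhabited
      ; sameCardinality = λ (_ , ∣D∣≡k) (_ , ∣D′∣≡k) → trans ∣D∣≡k (sym ∣D′∣≡k)
      ; defend          = defend
      }
      where
      defend : ∀ {D} → DominatingOfSize k D → ∀ w → ¬ w ∈ D →
               ∃[ D′ ] DominatingOfSize k D′ × w ∈ D′ × Reconfigures Γ D D′
      defend {D} (dom , ∣D∣≡k) w w∉D with toWitness dom w
      ... | u , u∈D , inj₁ refl = contradiction u∈D w∉D
      ... | u , u∈D , inj₂ u~w with shift u~w
      ...   | φ , refl = image π D
                       , (fromWitness (image-dominating φ (toWitness dom)) , trans (∣image∣ π D) ∣D∣≡k)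
                       , ∈-image⁺ π u∈D
                       , reconfigures-image φ D
        where π = Shift.perm φ

    -- A minimum dominating set is eternal by the configuration above; no eternal dominating set is
    -- smaller, since each one dominates.
    eternalDominationNumber≡dominationNumber :
      ∃[ k ] IsEternalDominationNumber Γ k × IsDominationNumber Γ k
    eternalDominationNumber≡dominationNumber
      with smallestSize dominating? (full , λ w → w , ∈⊤ , inj₁ refl)
    ... | k , (D , dom , ∣D∣≡k) , k≤ =
      k , ((D , (DominatingOfSize k , dominatingOfSize-configuration k (D , D∈) , D∈) , ∣D∣≡k)
          , λ E → k≤ E ∘ eternal⇒dominating)
        , (D , dom , ∣D∣≡k) , k≤
      where
      D∈ : DominatingOfSize k D
      D∈ = fromWitness dom , ∣D∣≡k

-- Generalised dihedral groups

module Dihedral {a ℓa c ℓ : Level} {A : AbelianGroup a ℓa} (G : FiniteGroup c ℓ)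
                (dih : GeneralisedDihedral A (FiniteGroup.group G)) where

  private module A = AbelianGroup A
  open FiniteGroup G hiding (sym; trans; refl)
  open FiniteGroup G using () renaming (sym to ≈-sym; trans to ≈-trans; refl to ≈-refl)
  open GeneralisedDihedral dih
  open GroupMorphisms A.rawGroup rawGroup using (module IsGroupMonomorphism)
  open IsGroupMonomorphism ι-monomorphism
    using (∙-homo; ⁻¹-homo) renaming (⟦⟧-cong to ι-cong)
  open GroupProperties group
  open SetoidReasoning setoid

  -- Products within and between the two cosets of `A`

  InA : Unary.Pred Carrier _
  InA g = ∃[ b ] g ≈ ι b

  InA-resp : ∀ {g h} → g ≈ h → InA h → InA g
  InA-resp g≈h (b , h≈ιb) = b , ≈-trans g≈h h≈ιb

  InXA-resp : ∀ {g h} → g ≈ h → InXA h → InXA g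
  InXA-resp g≈h (b , h≈xιb) = b , ≈-trans g≈h h≈xιb

  A∩xA≡∅ : ∀ {g} → InA g → ¬ InXA g
  A∩xA≡∅ {g} (b , g≈ιb) (d , g≈xιd) = x∉A (b A.∙ d A.⁻¹) (begin
    x                      ≈⟨ //-rightDividesʳ (ι d) x ⟨
    x ∙ ι d ∙ ι d ⁻¹       ≈⟨ ∙-congʳ (≈-trans (≈-sym g≈xιd) g≈ιb) ⟩
    ι b ∙ ι d ⁻¹           ≈⟨ ∙-congˡ (⁻¹-homo d) ⟨
    ι b ∙ ι (d A.⁻¹)       ≈⟨ ∙-homo b (d A.⁻¹) ⟨
    ι (b A.∙ d A.⁻¹)       ∎)

  A-comm : ∀ {g h} → InA g → InA h → g ∙ h ≈ h ∙ g
  A-comm {g} {h} (b , g≈ιb) (d , h≈ιd) = begin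
    g ∙ h          ≈⟨ ∙-cong g≈ιb h≈ιd ⟩
    ι b ∙ ι d      ≈⟨ ∙-homo b d ⟨
    ι (b A.∙ d)    ≈⟨ ι-cong (A.comm b d) ⟩
    ι (d A.∙ b)    ≈⟨ ∙-homo d b ⟩
    ι d ∙ ι b      ≈⟨ ∙-cong h≈ιd g≈ιb ⟨
    h ∙ g          ∎

  A-⁻¹ : ∀ {g} → InA g → InA (g ⁻¹)
  A-⁻¹ (b , g≈ιb) = b A.⁻¹ , ≈-trans (⁻¹-cong g≈ιb) (≈-sym (⁻¹-homo b))

  A∙A : ∀ {g h} → InA g → InA h → InA (g ∙ h)
  A∙A (b , g≈ιb) (d , h≈ιd) = b A.∙ d , ≈-trans (∙-cong g≈ιb h≈ιd) (≈-sym (∙-homo b d))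

  xA∙A : ∀ {y g} → InXA y → InA g → InXA (y ∙ g)
  xA∙A {y} {g} (b , y≈xιb) (d , g≈ιd) = b A.∙ d , (begin
    y ∙ g              ≈⟨ ∙-cong y≈xιb g≈ιd ⟩
    x ∙ ι b ∙ ι d      ≈⟨ assoc x (ι b) (ι d) ⟩
    x ∙ (ι b ∙ ι d)    ≈⟨ ∙-congˡ (∙-homo b d) ⟨
    x ∙ ι (b A.∙ d)    ∎)

  -- The relation `inverts`, turned into a rule for moving `x` leftwards past an element of `A`.
  A∙x : ∀ {g} → InA g → g ∙ x ≈ x ∙ g ⁻¹
  A∙x {g} (b , g≈ιb) = begin
    g ∙ x                       ≈⟨ ∙-congʳ (\\-leftDividesˡ x g) ⟨
    x ∙ (x ⁻¹ ∙ g) ∙ x          ≈⟨ assoc x (x ⁻¹ ∙ g) x ⟩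
    x ∙ (x ⁻¹ ∙ g ∙ x)          ≈⟨ ∙-congˡ (∙-congʳ (∙-congˡ g≈ιb)) ⟩
    x ∙ (x ⁻¹ ∙ ι b ∙ x)        ≈⟨ ∙-congˡ (inverts b) ⟩
    x ∙ ι (b A.⁻¹)              ≈⟨ ∙-congˡ (⁻¹-homo b) ⟩
    x ∙ ι b ⁻¹                  ≈⟨ ∙-congˡ (⁻¹-cong g≈ιb) ⟨
    x ∙ g ⁻¹                    ∎

  -- Every element of `xA` inverts `A`, as `x` does, because its factor `ι b` commutes with `g ⁻¹`.
  A-xA-swap : ∀ {g y} → InA g → InXA y → g ∙ y ≈ y ∙ g ⁻¹
  A-xA-swap {g} {y} g∈A (b , y≈xιb) = begin
    g ∙ y                ≈⟨ ∙-congˡ y≈xιb ⟩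
    g ∙ (x ∙ ι b)        ≈⟨ assoc g x (ι b) ⟨
    g ∙ x ∙ ι b          ≈⟨ ∙-congʳ (A∙x g∈A) ⟩
    x ∙ g ⁻¹ ∙ ι b       ≈⟨ assoc x (g ⁻¹) (ι b) ⟩
    x ∙ (g ⁻¹ ∙ ι b)     ≈⟨ ∙-congˡ (A-comm (A-⁻¹ g∈A) (b , ≈-refl)) ⟩
    x ∙ (ι b ∙ g ⁻¹)     ≈⟨ assoc x (ι b) (g ⁻¹) ⟨
    x ∙ ι b ∙ g ⁻¹       ≈⟨ ∙-congʳ y≈xιb ⟨
    y ∙ g ⁻¹             ∎

  A∙xA : ∀ {g y} → InA g → InXA y → InXA (g ∙ y)
  A∙xA g∈A y∈xA = InXA-resp (A-xA-swap g∈A y∈xA) (xA∙A y∈xA (A-⁻¹ g∈A))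

  xA∙xA : ∀ {y z} → InXA y → InXA z → InA (y ∙ z)
  xA∙xA {y} {z} (b , y≈xιb) (d , z≈xιd) = InA-resp (begin
    y ∙ z                      ≈⟨ ∙-cong y≈xιb z≈xιd ⟩
    x ∙ ι b ∙ (x ∙ ι d)        ≈⟨ assoc (x ∙ ι b) x (ι d) ⟨
    x ∙ ι b ∙ x ∙ ι d          ≈⟨ ∙-congʳ (assoc x (ι b) x) ⟩
    x ∙ (ι b ∙ x) ∙ ι d        ≈⟨ ∙-congʳ (∙-congˡ (A∙x (b , ≈-refl))) ⟩
    x ∙ (x ∙ ι b ⁻¹) ∙ ι d     ≈⟨ ∙-congʳ (assoc x x (ι b ⁻¹)) ⟨
    x ∙ x ∙ ι b ⁻¹ ∙ ι d       ≈⟨ ∙-congʳ (∙-congʳ x²≈ε) ⟩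
    ε ∙ ι b ⁻¹ ∙ ι d           ≈⟨ ∙-congʳ (identityˡ (ι b ⁻¹)) ⟩
    ι b ⁻¹ ∙ ι d               ∎) (A∙A (A-⁻¹ (b , ≈-refl)) (d , ≈-refl))

  -- Carrying `ι b` across the second `y` inverts it, and the inverse cancels the `ι b` inside that
  -- `y`, leaving `x ∙ x`.
  xA-involutive : ∀ {y} → InXA y → y ∙ y ≈ ε
  xA-involutive {y} y∈xA@(b , y≈xιb) = begin
    y ∙ y                      ≈⟨ ∙-congʳ y≈xιb ⟩
    x ∙ ι b ∙ y                ≈⟨ assoc x (ι b) y ⟩
    x ∙ (ι b ∙ y)              ≈⟨ ∙-congˡ (A-xA-swap (b , ≈-refl) y∈xA) ⟩
    x ∙ (y ∙ ι b ⁻¹)           ≈⟨ ∙-congˡ (∙-congʳ y≈xιb) ⟩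
    x ∙ (x ∙ ι b ∙ ι b ⁻¹)     ≈⟨ ∙-congˡ (//-rightDividesʳ (ι b) x) ⟩
    x ∙ x                      ≈⟨ x²≈ε ⟩
    ε                          ∎

  xA-cancelʳ : ∀ {y} → InXA y → ∀ g → g ∙ y ∙ y ≈ g
  xA-cancelʳ {y} y∈xA g = begin
    g ∙ y ∙ y      ≈⟨ assoc g y y ⟩
    g ∙ (y ∙ y)    ≈⟨ ∙-congˡ (xA-involutive y∈xA) ⟩
    g ∙ ε          ≈⟨ identityʳ g ⟩
    g              ∎

  -- Passing between group elements and indices

  element∘index : ∀ g → element (index g) ≈ g
  element∘index = Inverse.strictlyInverseʳ enumeration

  index∘element : ∀ i → index (element i) ≡ i
  index∘element = Inverse.strictlyInverseˡ enumeration

  index-cong : ∀ {g h} → g ≈ h → index g ≡ index h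
  index-cong = Inverse.to-cong enumeration

  index-injective : ∀ {g h} → index g ≡ index h → g ≈ h
  index-injective {g} {h} eq = begin
    g                    ≈⟨ element∘index g ⟨
    element (index g)    ≈⟨ Inverse.from-cong enumeration eq ⟩
    element (index h)    ≈⟨ element∘index h ⟩
    h                    ∎

  ∈xA⁺ : ∀ {g} → InXA g → g ∈ᴳ xA G dih
  ∈xA⁺ {g} g∈xA = ∈-tabulate⁺ (dec-true (inXA? _) (InXA-resp (element∘index g) g∈xA))

  ∈xA⁻ : ∀ {g} → g ∈ᴳ xA G dih → InXA g
  ∈xA⁻ {g} g∈ = InXA-resp (≈-sym (element∘index g)) (does⁻ (inXA? _) (∈-tabulate⁻ g∈))

  -- Permutations multiplying the two cosets by different elements

  slide : Carrier → Carrier → Fin order → Fin order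
  slide s t i = index (element i ∙ [ const s , const t ]′ (cosets (element i)))

  slide-A : ∀ s t i → InA (element i) → element (slide s t i) ≈ element i ∙ s
  slide-A s t i i∈A with cosets (element i)
  ... | inj₁ _    = element∘index _
  ... | inj₂ i∈xA = contradiction i∈xA (A∩xA≡∅ i∈A)

  slide-xA : ∀ s t i → InXA (element i) → element (slide s t i) ≈ element i ∙ t
  slide-xA s t i i∈xA with cosets (element i)
  ... | inj₁ i∈A = contradiction i∈xA (A∩xA≡∅ i∈A)
  ... | inj₂ _   = element∘index _

  -- Multiplying by elements of `xA` exchanges the cosets, so a vertex that was multiplied by `s` on
  -- `A` must be multiplied by `s` on `xA` on the way back: the arguments swap. Both elements are
  -- involutions, so the second multiplication undoes the first.
  slide-inverse : ∀ {s t} → InXA s → InXA t → ∀ i → slide t s (slide s t i) ≡ i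
  slide-inverse {s} {t} s∈xA t∈xA i = trans (sym (index∘element _))
    (trans (index-cong slide-back) (index∘element i))
    where
    slide-back : element (slide t s (slide s t i)) ≈ element i
    slide-back with cosets (element i)
    ... | inj₁ i∈A = begin
      element (slide t s (index (element i ∙ s)))  ≈⟨ slide-xA t s _ (InXA-resp (element∘index _) (A∙xA i∈A s∈xA)) ⟩
      element (index (element i ∙ s)) ∙ s          ≈⟨ ∙-congʳ (element∘index _) ⟩
      element i ∙ s ∙ s                            ≈⟨ xA-cancelʳ s∈xA _ ⟩
      element i                                    ∎
    ... | inj₂ i∈xA = begin
      element (slide t s (index (element i ∙ t)))  ≈⟨ slide-A t s _ (InA-resp (element∘index _) (xA∙xA i∈xA t∈xA)) ⟩
      element (index (element i ∙ t)) ∙ t          ≈⟨ ∙-congʳ (element∘index _) ⟩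
      element i ∙ t ∙ t                            ≈⟨ xA-cancelʳ t∈xA _ ⟩
      element i                                    ∎

  -- Shifts of a Cayley graph

  module _ (S : Subset order) (inv : InverseClosed S) where

    private Γ = Cay S inv

    -- Adjacency read on carriers, so that edges can be transported along `≈`; at `element u` and
    -- `element v` it is definitionally the adjacency of `Γ`.
    Adjacentᴳ : Carrier → Carrier → Set _
    Adjacentᴳ g h = ∃[ s ] s ∈ᴳ S × h ≈ g ∙ s

    Adjacentᴳ-resp : ∀ {g g′ h h′} → g′ ≈ g → h′ ≈ h → Adjacentᴳ g h → Adjacentᴳ g′ h′
    Adjacentᴳ-resp g′≈g h′≈h (s , s∈S , h≈gs) =
      s , s∈S , ≈-trans h′≈h (≈-trans h≈gs (∙-congʳ (≈-sym g′≈g)))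

    -- Up to `≈`, only `element u ⁻¹ ∙ element v` can label an edge from `u` to `v`, so one
    -- membership test decides.
    Cay-adjacent? : Decidable (Graph.Adjacent Γ)
    Cay-adjacent? u v = map′
      (λ q∈S → _ , q∈S , ≈-sym (\\-leftDividesˡ (element u) (element v)))
      (λ (s , s∈S , v≈us) → subst (_∈ S)
        (index-cong (≈-trans (≈-sym (\\-leftDividesʳ (element u) s)) (∙-congˡ (≈-sym v≈us)))) s∈S)
      (index (element u ⁻¹ ∙ element v) ∈? S)

    -- By associativity, left multiplication keeps the label of every edge. It moves `v` along `s`
    -- on `A`, where `s` and `v` commute, and along `s ⁻¹` on `xA`, where `v` inverts `s`.
    leftShift : ∀ {s} → InA s → s ∈ᴳ S → Shift Γ
    leftShift {s} s∈A s∈S = record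
      { perm     = permutation (left s) (left (s ⁻¹))
                     (left-inverse (\\-leftDividesˡ s)) (left-inverse (\\-leftDividesʳ s))
      ; preserve = λ {u} {v} (r , r∈S , v≈ur) → Adjacentᴳ-resp (element∘index _) (element∘index _)
          (r , r∈S , ≈-trans (∙-congˡ v≈ur) (≈-sym (assoc s (element u) r)))
      ; moves    = λ v → Adjacentᴳ-resp ≈-refl (element∘index _) (moves v)
      }
      where
      left : Carrier → Fin order → Fin order
      left g i = index (g ∙ element i)

      left-inverse : ∀ {g h} → (∀ k → g ∙ (h ∙ k) ≈ k) → ∀ i → left g (left h i) ≡ i
      left-inverse gh≈id i = trans
        (index-cong (≈-trans (∙-congˡ (element∘index _)) (gh≈id (element i)))) (index∘element i)

      moves : ∀ v → Adjacentᴳ (element v) (s ∙ element v)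
      moves v with cosets (element v)
      ... | inj₁ v∈A  = s , s∈S , A-comm s∈A v∈A
      ... | inj₂ v∈xA = s ⁻¹ , inv s s∈S , A-xA-swap s∈A v∈xA

    -- An edge with label in `A` stays inside one coset and has its label inverted (`inner`). An
    -- edge with label in `xA` joins the two cosets, and by `only` its label is `s` or `t`
    -- (`cross`).
    slideShift : ∀ {s t} → InXA s → InXA t → s ∈ᴳ S → t ∈ᴳ S →
                 (∀ {r} → InXA r → r ∈ᴳ S → r ≈ s ⊎ r ≈ t) → Shift Γ
    slideShift {s} {t} s∈xA t∈xA s∈S t∈S only = record
      { perm     = permutation (slide s t) (slide t s)
                     (slide-inverse t∈xA s∈xA) (slide-inverse s∈xA t∈xA)
      ; preserve = preserve
      ; moves    = moves
      }
      where
      inner : ∀ {y g h r} → InXA y → InA r → r ∈ᴳ S → h ≈ g ∙ r → Adjacentᴳ (g ∙ y) (h ∙ y)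
      inner {y} {g} {h} {r} y∈xA r∈A r∈S h≈gr = r ⁻¹ , inv r r∈S , (begin
        h ∙ y              ≈⟨ ∙-congʳ h≈gr ⟩
        g ∙ r ∙ y          ≈⟨ assoc g r y ⟩
        g ∙ (r ∙ y)        ≈⟨ ∙-congˡ (A-xA-swap r∈A y∈xA) ⟩
        g ∙ (y ∙ r ⁻¹)     ≈⟨ assoc g y (r ⁻¹) ⟨
        g ∙ y ∙ r ⁻¹       ∎)

      -- Here `y` multiplies the coset of `g` and `z` that of `h`. If `r` is `y`, then `h` is
      -- `g ∙ y` and the new label is `z`. If `r` is `z`, then `h ∙ z` returns to `g`, which `y`
      -- reaches from `g ∙ y`.
      cross : ∀ {y z g h r} → InXA y → InXA z → y ∈ᴳ S → z ∈ᴳ S → r ≈ y ⊎ r ≈ z →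
              h ≈ g ∙ r → Adjacentᴳ (g ∙ y) (h ∙ z)
      cross {z = z} _ _ _ z∈S (inj₁ r≈y) h≈gr = z , z∈S , ∙-congʳ (≈-trans h≈gr (∙-congˡ r≈y))
      cross {y} {z} {g} {h} {r} y∈xA z∈xA y∈S _ (inj₂ r≈z) h≈gr = y , y∈S , (begin
        h ∙ z          ≈⟨ ∙-congʳ (≈-trans h≈gr (∙-congˡ r≈z)) ⟩
        g ∙ z ∙ z      ≈⟨ xA-cancelʳ z∈xA g ⟩
        g              ≈⟨ xA-cancelʳ y∈xA g ⟨
        g ∙ y ∙ y      ∎)

      preserve : ∀ {u v} → Graph.Adjacent Γ u v → Graph.Adjacent Γ (slide s t u) (slide s t v)
      preserve {u} {v} (r , r∈S , v≈ur) with cosets (element u) | cosets r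
      -- The case split evaluates the slide at `u` only; the multiplier at `v` is determined from
      -- the cosets of `u` and `r`.
      ... | inj₁ u∈A  | inj₁ r∈A  = Adjacentᴳ-resp (element∘index _)
              (slide-A s t v (InA-resp v≈ur (A∙A u∈A r∈A))) (inner s∈xA r∈A r∈S v≈ur)
      ... | inj₁ u∈A  | inj₂ r∈xA = Adjacentᴳ-resp (element∘index _)
              (slide-xA s t v (InXA-resp v≈ur (A∙xA u∈A r∈xA)))
              (cross s∈xA t∈xA s∈S t∈S (only r∈xA r∈S) v≈ur)
      ... | inj₂ u∈xA | inj₁ r∈A  = Adjacentᴳ-resp (element∘index _)
              (slide-xA s t v (InXA-resp v≈ur (xA∙A u∈xA r∈A))) (inner t∈xA r∈A r∈S v≈ur)
      -- The multiplier at `u` is now `t`, so `cross` takes `s` and `t` in exchanged roles.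
      ... | inj₂ u∈xA | inj₂ r∈xA = Adjacentᴳ-resp (element∘index _)
              (slide-A s t v (InA-resp v≈ur (xA∙xA u∈xA r∈xA)))
              (cross t∈xA s∈xA t∈S s∈S ([ inj₂ , inj₁ ]′ (only r∈xA r∈S)) v≈ur)

      moves : ∀ v → Graph.Adjacent Γ v (slide s t v)
      moves v with cosets (element v)
      ... | inj₁ _ = s , s∈S , element∘index _
      ... | inj₂ _ = t , t∈S , element∘index _

    module _ (∣S∩xA∣≤2 : ∣ S ∩ xA G dih ∣ ≤ 2) where

      -- If `s` is the only element of `S` in `xA`, then `t` is `s` again, and the resulting slide
      -- is right multiplication by `s`.
      xA-partner : ∀ {s} → InXA s → s ∈ᴳ S →
                   ∃[ t ] InXA t × t ∈ᴳ S × (∀ {r} → InXA r → r ∈ᴳ S → r ≈ s ⊎ r ≈ t)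
      xA-partner {s} s∈xA s∈S with ∣p∣≤2⇒partner _ ∣S∩xA∣≤2 (x∈p∩q⁺ (s∈S , ∈xA⁺ s∈xA))
      ... | j , j∈ , only =
        element j , ∈xA⁻ (proj₂ t∈) , proj₁ t∈ , λ r∈xA r∈S →
          [ inj₁ ∘ index-injective
          , (λ r≡j → inj₂ (index-injective (trans r≡j (sym (index∘element j))))) ]′
          (only (x∈p∩q⁺ (r∈S , ∈xA⁺ r∈xA)))
        where
        t∈ : element j ∈ᴳ S × element j ∈ᴳ xA G dih
        t∈ = x∈p∩q⁻ S _ (subst (_∈ S ∩ xA G dih) (sym (index∘element j)) j∈)

      Cay-shift : ∀ {u w} → Graph.Adjacent Γ u w → ∃[ φ ] Shift.perm {Γ = Γ} φ ⟨$⟩ʳ u ≡ w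
      Cay-shift {u} {w} (s , s∈S , w≈us) with cosets (element u) | cosets s
      ... | inj₁ u∈A  | inj₁ s∈A  = leftShift s∈A s∈S ,
              trans (index-cong (≈-trans (A-comm s∈A u∈A) (≈-sym w≈us))) (index∘element w)
      -- Since `u` inverts `A`, left multiplication by `s ⁻¹` sends `u` to `u ∙ s`.
      ... | inj₂ u∈xA | inj₁ s∈A  = leftShift (A-⁻¹ s∈A) (inv s s∈S) ,
              trans (index-cong (≈-trans (A-xA-swap (A-⁻¹ s∈A) u∈xA)
                (≈-trans (∙-congˡ (⁻¹-involutive s)) (≈-sym w≈us)))) (index∘element w)
      ... | inj₁ u∈A  | inj₂ s∈xA = let t , t∈xA , t∈S , only = xA-partner s∈xA s∈S in
              slideShift s∈xA t∈xA s∈S t∈S only ,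
              trans (sym (index∘element _))
                (trans (index-cong (≈-trans (slide-A s t u u∈A) (≈-sym w≈us))) (index∘element w))
      -- The arguments are ordered so that the coset of `u`, now `xA`, is the one multiplied by `s`.
      ... | inj₂ u∈xA | inj₂ s∈xA = let t , t∈xA , t∈S , only = xA-partner s∈xA s∈S in
              slideShift t∈xA s∈xA t∈S s∈S (λ r∈xA r∈S → [ inj₂ , inj₁ ]′ (only r∈xA r∈S)) ,
              trans (sym (index∘element _))
                (trans (index-cong (≈-trans (slide-xA t s u u∈xA) (≈-sym w≈us))) (index∘element w))

theorem3p6 : ∀ {a ℓa c ℓ : Level} (n : ℕ) (A : AbelianGroup a ℓa) (G : FiniteGroup c ℓ) →
    let open FiniteGroup G in
    order ≡ 2 * n →
    (dih : GeneralisedDihedral A group) →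
    (S : Subset order) (inv : InverseClosed S) →
    ∣ S ∩ xA G dih ∣ ≤ 2 →
    ∃[ k ] IsEternalDominationNumber (Cay S inv) k × IsDominationNumber (Cay S inv) k
theorem3p6 n A G _ dih S inv ∣S∩xA∣≤2 =
  eternalDominationNumber≡dominationNumber (FiniteGroup.Cay G S inv)
    (Cay-adjacent? S inv) (Cay-shift S inv ∣S∩xA∣≤2)
  where open Dihedral G dih
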